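{- The unique solution $(x,y,z)\in\mathbb{N}^3$ of the equation $2\cdot 3^x+2^y=z^2$ is $(x,y,z)=(0,1,2)$.
   Context: $\mathbb{N}=\{0,1,2,3,\ldots\}$ denotes the set of non-negative integers. -}

module Defs where

{-# OPTIONS --safe #-}
module Submission where

open import Data.Nat using (ℕ; _+_; _*_; _^_)
open import Data.Product using (_,_)
open import Function.Bundles using (_⇔_)
open import Relation.Binary.PropositionalEquality using (_≡_)
open import Defs

open import Data.Empty using (⊥-elim)
open import Data.Fin using (toℕ; fromℕ<)
open import Data.Fin.Properties using (all?; toℕ-fromℕ<)
open import Data.Nat using (zero; suc; NonZero; _%_; _≟_)
open import Data.Nat.DivMod using (%-distribˡ-*; [m+kn]%n≡m%n; m%n<n)
open import Data.Nat.Properties using (*-identityʳ; <-cmp; <⇒≢; ^-monoˡ-<)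
open import Data.Nat.Tactic.RingSolver using (solve-∀)
open import Data.Product using (∃)
open import Function.Bundles using (mk⇔)
open import Relation.Binary.Definitions using (tri<; tri≈; tri>)
open import Relation.Binary.PropositionalEquality
  using (_≢_; refl; sym; trans; cong; module ≡-Reasoning)
open import Relation.Nullary.Decidable using (True; toWitness; ¬?)

-- Modulo 4 the left-hand side is 3 if y = 0 and 2 if y ≥ 2, and for y = 1 and
-- x ≥ 1 it is 2 modulo 3; none of these is a quadratic residue.  This leaves
-- x = 0, y = 1 and z² = 4.

-- Since `3 ^ x` is odd (`3^n-odd`), `2 * 3 ^ x` is always 2 modulo 4, so the residue modulo 4
-- depends only on `2 ^ y`. Squares are 0 or 1 modulo 4 and also modulo 3; `square-nonresidue` turns
-- this into contradictions, and `square-injective` recovers `z` in the one surviving case.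

%-square : ∀ z d .{{_ : NonZero d}} → z ^ 2 % d ≡ (z % d) ^ 2 % d
%-square z d = begin
  -- `z ^ 2` unfolds to `z * (z * 1)`; the trailing 1 must go before the product rule applies.
  z ^ 2 % d                  ≡⟨ cong (λ w → z * w % d) (*-identityʳ z) ⟩
  z * z % d                  ≡⟨ %-distribˡ-* z z d ⟩
  (z % d) * (z % d) % d      ≡⟨ cong (λ w → (z % d) * w % d) (*-identityʳ (z % d)) ⟨
  (z % d) ^ 2 % d            ∎
  where open ≡-Reasoning

-- A square modulo `d` depends only on its root modulo `d`, so finitely many roots need testing. For
-- concrete `d` and `r` the implicit `True` argument is settled by evaluating that test.
square-nonresidue : ∀ d r .{{_ : NonZero d}} →
  {True (all? {n = d} (λ i → ¬? (toℕ i ^ 2 % d ≟ r)))} →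
  ∀ z → z ^ 2 % d ≢ r
square-nonresidue d r {checked} z z²%d≡r =
  toWitness checked (fromℕ< (m%n<n z d)) (begin
    toℕ (fromℕ< (m%n<n z d)) ^ 2 % d  ≡⟨ cong (λ w → w ^ 2 % d) (toℕ-fromℕ< (m%n<n z d)) ⟩
    (z % d) ^ 2 % d                   ≡⟨ %-square z d ⟨
    z ^ 2 % d                         ≡⟨ z²%d≡r ⟩
    r                                 ∎)
  where open ≡-Reasoning

square-injective : ∀ {m n} → m ^ 2 ≡ n ^ 2 → m ≡ n
square-injective {m} {n} m²≡n² with <-cmp m n
... | tri< m<n _ _ = ⊥-elim (<⇒≢ (^-monoˡ-< 2 m<n) m²≡n²)
... | tri≈ _ m≡n _ = m≡n
... | tri> _ _ n<m = ⊥-elim (<⇒≢ (^-monoˡ-< 2 n<m) (sym m²≡n²))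

-- The explicit `k` lets the sums below be rewritten as a constant plus a multiple of 4.
3^n-odd : ∀ n → ∃ λ k → 3 ^ n ≡ 1 + 2 * k
3^n-odd zero    = 0 , refl
3^n-odd (suc n) with k , 3^n≡1+2k ← 3^n-odd n =
  1 + 3 * k , trans (cong (3 *_) 3^n≡1+2k) (triple k)
  where
  triple : ∀ k → 3 * (1 + 2 * k) ≡ 1 + 2 * (1 + 3 * k)
  triple = solve-∀

2*3^x+1≡3[mod4] : ∀ x → (2 * 3 ^ x + 1) % 4 ≡ 3
2*3^x+1≡3[mod4] x with k , 3^x≡1+2k ← 3^n-odd x = begin
  (2 * 3 ^ x + 1) % 4        ≡⟨ cong (λ w → (2 * w + 1) % 4) 3^x≡1+2k ⟩
  (2 * (1 + 2 * k) + 1) % 4  ≡⟨ cong (_% 4) (regroup k) ⟩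
  (3 + k * 4) % 4            ≡⟨ [m+kn]%n≡m%n 3 k 4 ⟩
  3                          ∎
  where
  open ≡-Reasoning
  regroup : ∀ k → 2 * (1 + 2 * k) + 1 ≡ 3 + k * 4
  regroup = solve-∀

2*3^x+2^[2+y]≡2[mod4] : ∀ x y → (2 * 3 ^ x + 2 ^ (2 + y)) % 4 ≡ 2
2*3^x+2^[2+y]≡2[mod4] x y with k , 3^x≡1+2k ← 3^n-odd x = begin
  (2 * 3 ^ x + 2 ^ (2 + y)) % 4        ≡⟨ cong (λ w → (2 * w + 2 ^ (2 + y)) % 4) 3^x≡1+2k ⟩
  (2 * (1 + 2 * k) + 2 ^ (2 + y)) % 4  ≡⟨ cong (_% 4) (regroup k (2 ^ y)) ⟩
  (2 + (k + 2 ^ y) * 4) % 4            ≡⟨ [m+kn]%n≡m%n 2 (k + 2 ^ y) 4 ⟩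
  2                                    ∎
  where
  open ≡-Reasoning
  -- Here `p` stands for `2 ^ y`, as `2 ^ (2 + y)` computes to `2 * (2 * 2 ^ y)`.
  regroup : ∀ k p → 2 * (1 + 2 * k) + 2 * (2 * p) ≡ 2 + (k + p) * 4
  regroup = solve-∀

-- Modulo 4 this sum is 0, which is a square, so another modulus is needed; modulo 3 the power of 3
-- vanishes and only the 2 from `2 ^ 1` remains.
2*3^[1+x]+2≡2[mod3] : ∀ x → (2 * 3 ^ (1 + x) + 2) % 3 ≡ 2
2*3^[1+x]+2≡2[mod3] x =
  trans (cong (_% 3) (regroup (3 ^ x))) ([m+kn]%n≡m%n 2 (2 * 3 ^ x) 3)
  where
  regroup : ∀ t → 2 * (3 * t) + 2 ≡ 2 + 2 * t * 3
  regroup = solve-∀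

solution-unique : ∀ x y z → 2 * 3 ^ x + 2 ^ y ≡ z ^ 2 → (x , y , z) ≡ (0 , 1 , 2)
solution-unique x 0 z eq =
  ⊥-elim (square-nonresidue 4 3 z (trans (cong (_% 4) (sym eq)) (2*3^x+1≡3[mod4] x)))
-- The left-hand side evaluates to 4, which is also the value of `2 ^ 2`, so `sym eq` compares two
-- squares.
solution-unique zero 1 z eq = cong (λ w → 0 , 1 , w) (square-injective (sym eq))
solution-unique (suc x) 1 z eq =
  ⊥-elim (square-nonresidue 3 2 z (trans (cong (_% 3) (sym eq)) (2*3^[1+x]+2≡2[mod3] x)))
solution-unique x (suc (suc y)) z eq =
  ⊥-elim (square-nonresidue 4 2 z (trans (cong (_% 4) (sym eq)) (2*3^x+2^[2+y]≡2[mod4] x y)))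

theorem0p15 : ∀ (x y z : ℕ) →
    (2 * 3 ^ x + 2 ^ y ≡ z ^ 2) ⇔ ((x , y , z) ≡ (0 , 1 , 2))
theorem0p15 x y z = mk⇔ (solution-unique x y z) λ { refl → refl }
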